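{- Refutation schemata are sound: if $R=\langle\Theta,\mathcal{A},\rho\rangle$ is a refutation schema and $N$ is a natural number, then $R\downarrow N$ is a $w$-resolution deduction from $\Theta\downarrow N$ (i.e. from the clause set $|\Theta\downarrow N|$).
   Context: **Basics.** Arithmetic expressions are $\alpha\times n+\beta$ with $\alpha,\beta\in\mathbb{N}$ and $n$ the single parameter; $(\alpha\times n+\beta)\downarrow N=\alpha N+\beta$; $a[n\mapsto b]$ is substitution. An atom is $P(\alpha)$ with $P$ a propositional symbol and $\alpha\in\mathbb{N}$; an atom schema is $P(a)$ with $a$ an arithmetic expression. Propositional schemata are built from atom schemata and a variable $X^{\mathrm{prop}}$ by $\neg,\wedge,\vee,\supset$ and expressions $\mathbf{P}(a)$, where $\mathbf{P}$ is a defined symbol with specification $\mathbf{P}(0)\equiv F_{base}$ (a propositional formula), $\mathbf{P}(n+1)\equiv F_{rec}$ (a schema that may contain $X^{\mathrm{prop}}$, standing for $\mathbf{P}(n)$, and previously defined symbols but not $\mathbf{P}$); outside specifications, schemata do not contain $X^{\mathrm{prop}}$. Evaluation $F\downarrow N$ replaces $n$ by $N$ and unfolds definitions. The relation $\leftrightarrow_{def}$ is the reflexive symmetric closure of $\mathbf{P}(0)\leftrightarrow_{def}F_{base}$, $\mathbf{P}(\alpha\times n+(\beta+1))\leftrightarrow_{def}F_{rec}[n\mapsto\alpha\times n+\beta][X^{\mathrm{prop}}\mapsto\mathbf{P}(\alpha\times n+\beta)]$, extended componentwise to sequents. A sequent (schema) is $\Gamma\vdash\Delta$ with $\Gamma,\Delta$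 finite lists of formulas (schemata); a clause (schema) is a sequent of atoms (atom schemata), clauses being identified up to order of atoms. $(\Gamma\vdash\Delta)\circ(\Pi\vdash\Lambda)=\Gamma,\Pi\vdash\Delta,\Lambda$; $\mathcal{C}\times\mathcal{D}=\{C\circ D\mid C\in\mathcal{C},D\in\mathcal{D}\}$. **Proof schemata.** Initial sequents are $P(a)\vdash P(a)$. Inference rules: left/right weakening, contraction, exchange; cut (from $\Gamma\vdash\Delta,F$ and $F,\Pi\vdash\Lambda$ infer $\Gamma,\Pi\vdash\Delta,\Lambda$); $\neg\colon l,\neg\colon r$; $\wedge\colon l_1$, $\wedge\colon l_2$ (from $F,\Gamma\vdash\Delta$, resp. $G,\Gamma\vdash\Delta$, infer $F\wedge G,\Gamma\vdash\Delta$); $\wedge\colon r$ (from $\Gamma\vdash\Delta,F$ and $\Gamma\vdash\Delta,G$ infer $\Gamma\vdash\Delta,F\wedge G$); $\vee\colon l$ (from $F,\Gamma\vdash\Delta$ and $G,\Gamma\vdash\Delta$ infer $F\vee G,\Gamma\vdash\Delta$), $\vee\colon r_1$, $\vee\colon r_2$ dually to $\wedge\colon l$; $\supset\colon l$ (from $\Gamma\vdash\Delta,F$ and $G,\Pi\vdash\Lambda$ infer $F\supset G,\Gamma,\Pi\vdash\Delta,\Lambda$); $\supset\colon r$ (from $F,\Gamma\vdash\Delta,G$ infer $\Gamma\vdash\Delta,F\supset G$); the rule $def$ (from $S$ infer $S'$ if $S\leftrightarrow_{def}S'$); and proof links. Proof schemata are built inductively from initial sequents, these inferences, and expressions $\boldsymbol{\varphi}(a)$,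 where $\boldsymbol{\varphi}$ is specified by $\boldsymbol{\varphi}(0)\equiv\varphi_{base}$, a propositional proof of $S\downarrow 0$, and $\boldsymbol{\varphi}(n+1)\equiv\varphi_{rec}$, a proof schema of $S[n\mapsto n+1]$ which may use proof links $\boldsymbol{\varphi}(n)$ as leaves with sequent $S$ (and previously defined proof schemata); then $\boldsymbol{\varphi}(a)$ has end-sequent $S[n\mapsto a]$. Outside specifications no proof links occur. **Clause set term schemata.** Built from $[C]$ ($C$ a clause schema), variables $X_1^{\mathrm{term}},X_2^{\mathrm{term}},\dots$, $\oplus$, $\otimes$, and $\mathbf{T}(a)$, where symbols $\mathbf{T}^1,\dots,\mathbf{T}^M$ are defined by mutual recursion $\mathbf{T}^i(0)\equiv T^i_{base}$ (ground), $\mathbf{T}^i(n+1)\equiv T^i_{rec}$, in which $X_j^{\mathrm{term}}$ stands for $\mathbf{T}^j(n)$ (previously defined symbols may occur); outside specifications no variables occur. $T\downarrow N$ evaluates to a ground term; $|[C]|=\{C\}$, $|X\oplus Y|=|X|\cup|Y|$, $|X\otimes Y|=|X|\times|Y|$. **Characteristic term schema.** A configuration $\Omega$ of a sequent marks each formula occurrence by $\blacksquare$ (tracked) or $\square$; $S\cdot\Omega$ is the subsequent of tracked formulas; $\varnothing$ tracks nothing. A configuration on the conclusion of an inference induces one on each premise: context formulas keep their mark, auxiliary formulas get the mark of the principal formula, both cut formulas get $\blacksquare$, structural rules copy marks in the obvious way. $\Theta^{\Omega}(\varphi)$ is: $[S\cdot\Omega]$ for an initial sequent $S$; $\Theta^{\Omega'}(\varphi')$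 (with $\Omega'$ induced) for a last unary inference (including $def$); for a last binary inference with subproofs $\varphi_1,\varphi_2$ and induced configurations $\Omega_1,\Omega_2$, $\Theta^{\Omega_1}(\varphi_1)\oplus\Theta^{\Omega_2}(\varphi_2)$ if it is a cut or its principal formula is tracked, and $\Theta^{\Omega_1}(\varphi_1)\otimes\Theta^{\Omega_2}(\varphi_2)$ otherwise; a variable $X_{\Omega}^{\mathrm{term}}$ (standing for $\Theta^{\Omega}(\boldsymbol{\psi})(n)$) for a proof link $\boldsymbol{\psi}(n)$; and $\Theta^{\Omega}(\boldsymbol{\psi})(a)$ for $\boldsymbol{\psi}(a)$, where the $\Theta^{\Omega_i}(\boldsymbol{\psi})$, $\Omega_i$ ranging over all configurations of the end-sequent of $\boldsymbol\psi$, are defined by mutual recursion $\Theta^{\Omega_i}(\boldsymbol{\psi})(0)\equiv\Theta^{\Omega_i}(\psi_{base})$, $\Theta^{\Omega_i}(\boldsymbol{\psi})(n+1)\equiv\Theta^{\Omega_i}(\psi_{rec})$. A characteristic term schema is $\Theta=\Theta^{\varnothing}(\varphi)$ for a proof schema $\varphi$; every $|\Theta\downarrow N|$ is an unsatisfiable clause set. **Atom set schemata and top clause sets.** An atom set schema is a finite set $\mathcal{A}$ of pairs $\langle P,a\rangle$ with $P$ a propositional symbol and $a$ an arithmetic expression; $\mathcal{A}\downarrow N=\bigcup_{\langle P,a\rangle\in\mathcal{A}}\{P(0),P(1),\dots,P(a\downarrow N)\}$. It is an atom set schema for $T$ if for every $N$ all atoms occurring in clauses of $|T\downarrow N|$ lie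 in $\mathcal{A}\downarrow N$. The top clause set is $\mathrm{CL}^t(\{A_1,\dots,A_k\})=\{A_1\vdash;\ \vdash A_1\}\times\dots\times\{A_k\vdash;\ \vdash A_k\}$, and $\mathrm{CL}^t(\emptyset)=\{\vdash\}$. **Resolution.** For clauses $C=\Gamma\vdash\Delta$, $D=\Pi\vdash\Lambda$ and an atom $A$, $\mathrm{res}(C,D;A)=\Gamma,\Pi'\vdash\Delta',\Lambda$, where $\Pi',\Delta'$ are $\Pi,\Delta$ with all occurrences of $A$ removed. $C\leq D$ ($C$ subsumes $D$) iff $\mathrm{set}(\Gamma)\subseteq\mathrm{set}(\Pi)$ and $\mathrm{set}(\Delta)\subseteq\mathrm{set}(\Lambda)$. Resolution deductions from a clause set $\mathcal{C}$: each $C\in\mathcal{C}$, with end-clause $C$; and $\mathrm{r}(\gamma_1,\gamma_2;A)$, with end-clause the resolvent with respect to $A$ of the end-clauses of $\gamma_1,\gamma_2$. $w$-resolution deductions have in addition weakening terms $w(\gamma;D)$ for any clause $D$, with end-clause $C\circ D$ where $C$ is the end-clause of $\gamma$. Resolution proof schemata: clause schemata are extended by clause variables $X_i^{\mathrm{clause}}$, composition $\circ$, and clause schemata defined by primitive recursion in $n$; resolution proof schemata are clause schemata, $\mathrm{r}(\rho_1,\rho_2;A)$ with $A$ an atom schema, and $\boldsymbol{\rho}(a;C_1,\dots,C_k)$ with $C_i$ clause schemata and $\boldsymbol{\rho}$ specified by $\boldsymbol{\rho}(0;\vec X^{\mathrm{clause}})\equiv\rho_{base}$, $\boldsymbol{\rho}(n+1;\vec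 X^{\mathrm{clause}})\equiv\rho_{rec}$, where $\rho_{rec}$ may contain recursive calls $\boldsymbol{\rho}(n;D_1,\dots,D_k)$ with clause schemata $D_i$, and both may contain the variables $\vec X^{\mathrm{clause}}$ and previously defined symbols. For closed $\rho$, $\rho\downarrow N$ is obtained by setting $n=N$ and unfolding. **Refutation schema.** A triple $\langle\Theta,\mathcal{A},\rho\rangle$ with $\Theta$ a characteristic term schema, $\mathcal{A}$ an atom set schema for $\Theta$, and $\rho$ a resolution proof schema such that for every $N$, $\rho\downarrow N$ is a resolution deduction from $\mathrm{CL}^t(\mathcal{A}\downarrow N)$ with end-clause $\vdash$. Its evaluation $\langle\Theta,\mathcal{A},\rho\rangle\downarrow N$ is obtained from $\rho\downarrow N$ by replacing every clause $D$ which is a leaf with a weakening term $w(C;D)$ such that $C\in|\Theta\downarrow N|$ and $C\leq D$ (such $C$ always exists). -}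

module Defs where

open import Data.Empty using (⊥; ⊥-elim)
open import Data.Fin.Base using (Fin; zero; suc)
open import Data.List.Base
  using (List; []; _∷_; _++_; _∷ʳ_; map; concatMap; filter; foldr; upTo; deduplicate; cartesianProductWith)
open import Data.List.Membership.Propositional using (_∈_)
open import Data.List.Relation.Binary.Permutation.Propositional using (_↭_)
open import Data.List.Relation.Binary.Pointwise.Base using (Pointwise; []; _∷_)
open import Data.List.Relation.Binary.Subset.Propositional using (_⊆_)
open import Data.List.Relation.Unary.All using (All; []; _∷_; universal)
open import Data.List.Relation.Unary.All.Properties using (map⁺; map⁻; ++⁺; ++⁻ˡ; ++⁻ʳ)
open import Data.List.Relation.Unary.Any using (Any; here; there)
open import Data.Maybe.Base using (Maybe; maybe)
open import Data.Nat.Base using (ℕ; zero; suc; _+_; _*_)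
import Data.Nat.Properties as ℕ
open import Data.Product.Base using (_×_; _,_; ∃; map₂)
open import Data.Product.Properties using (≡-dec)
open import Data.Sum.Base using (_⊎_; inj₁; inj₂)
open import Data.Unit.Base using (⊤; tt)
open import Data.Vec.Functional using (Vector)
open import Function.Base using (_∘_; id; const)
open import Relation.Binary.Construct.Closure.Reflexive using (ReflClosure)
open import Relation.Binary.Construct.Closure.Symmetric using (SymClosure)
open import Relation.Binary.Core using (Rel)
open import Relation.Binary.Definitions using (DecidableEquality)
open import Relation.Binary.PropositionalEquality.Core using (_≡_; refl; subst)
import Relation.Binary.PropositionalEquality.Core as ≡
open import Relation.Nullary.Decidable.Core using (¬?)
open import Level using (0ℓ)

infix  9 _×n+_
infix  4 _⊢_

record Arith : Set where
  constructor _×n+_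
  field
    slope offset : ℕ

_↓ᵃ_ : Arith → ℕ → ℕ
(α ×n+ β) ↓ᵃ N = α * N + β

_[_]ᵃ : Arith → Arith → Arith
(α ×n+ β) [ γ ×n+ δ ]ᵃ = (α * γ) ×n+ (α * δ + β)

numeral : ℕ → Arith
numeral = 0 ×n+_

n+1 : Arith
n+1 = 1 ×n+ 1

PropSym : Set
PropSym = ℕ

-- Atom ℕ is the type of atoms, Atom Arith that of atom schemata.  Likewise
-- below: the index type is ℕ where the parameter n must not occur.
Atom : Set → Set
Atom E = PropSym × E

_≟ᴬ_ : DecidableEquality (Atom ℕ)
_≟ᴬ_ = ≡-dec ℕ._≟_ ℕ._≟_

record Sequent (A : Set) : Set where
  constructor _⊢_
  field
    ant con : List A

open Sequent public

mapˢ : {A B : Set} → (A → B) → Sequent A → Sequent B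
mapˢ f S = map f (ant S) ⊢ map f (con S)

_∘ˢ_ : {A : Set} → Sequent A → Sequent A → Sequent A
(Γ ⊢ Δ) ∘ˢ (Π ⊢ Λ) = (Γ ++ Π) ⊢ (Δ ++ Λ)

Clause : Set → Set
Clause E = Sequent (Atom E)

_≈ᶜ_ : Rel (Clause ℕ) 0ℓ
(Γ ⊢ Δ) ≈ᶜ (Π ⊢ Λ) = (Γ ↭ Π) × (Δ ↭ Λ)

-- A finite set of clauses, clauses being identified up to ≈ᶜ.
ClauseSet : Set
ClauseSet = List (Clause ℕ)

_∈ᶜ_ : Clause ℕ → ClauseSet → Set
C ∈ᶜ 𝒞 = Any (C ≈ᶜ_) 𝒞

_×ᶜ_ : ClauseSet → ClauseSet → ClauseSet
_×ᶜ_ = cartesianProductWith _∘ˢ_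

-- Subsumption.
_≤ᶜ_ : Rel (Clause ℕ) 0ℓ
(Γ ⊢ Δ) ≤ᶜ (Π ⊢ Λ) = (Γ ⊆ Π) × (Δ ⊆ Λ)

infixr 7 _∧'_
infixr 6 _∨'_
infixr 5 _⊃'_

data Formula (A : Set) : Set where
  leaf           : A → Formula A
  ¬'_            : Formula A → Formula A
  _∧'_ _∨'_ _⊃'_ : Formula A → Formula A → Formula A

bindᶠ : {A B : Set} → (A → Formula B) → Formula A → Formula B
bindᶠ f (leaf a) = f a
bindᶠ f (¬' F)   = ¬' bindᶠ f F
bindᶠ f (F ∧' G) = bindᶠ f F ∧' bindᶠ f G
bindᶠ f (F ∨' G) = bindᶠ f F ∨' bindᶠ f G
bindᶠ f (F ⊃' G) = bindᶠ f F ⊃' bindᶠ f G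

PropFormula : Set
PropFormula = Formula (Atom ℕ)

-- k is the number of defined symbols in scope, the most recent one being
-- zero; V is ⊤ if X^prop may occur and ⊥ otherwise.
data Leaf (k : ℕ) (V : Set) : Set where
  atom : Atom Arith → Leaf k V
  sym  : Fin k → Arith → Leaf k V
  Xᵖ   : V → Leaf k V

Schema : ℕ → Set
Schema k = Formula (Leaf k ⊥)

record FormulaSpec (k : ℕ) : Set where
  field
    base : PropFormula
    rec  : Formula (Leaf k ⊤)

data FormulaDefs : ℕ → Set where
  []  : FormulaDefs 0
  _▸_ : ∀ {k} → FormulaDefs k → FormulaSpec k → FormulaDefs (suc k)

substLeaf : ∀ {k V} → Arith → Leaf k V → Leaf k V
substLeaf a (atom A)  = atom (map₂ _[ a ]ᵃ A)
substLeaf a (sym P b) = sym P (b [ a ]ᵃ)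
substLeaf a (Xᵖ x)    = Xᵖ x

_[_]ᶠ : ∀ {k V} → Formula (Leaf k V) → Arith → Formula (Leaf k V)
F [ a ]ᶠ = bindᶠ (leaf ∘ substLeaf a) F

fillLeaf : ∀ {k V} → Formula (Leaf k V) → Leaf k ⊤ → Formula (Leaf k V)
fillLeaf G (atom A)  = leaf (atom A)
fillLeaf G (sym P b) = leaf (sym P b)
fillLeaf G (Xᵖ _)    = G

_[X↦_]ᶠ : ∀ {k V} → Formula (Leaf k ⊤) → Formula (Leaf k V) → Formula (Leaf k V)
F [X↦ G ]ᶠ = bindᶠ (fillLeaf G) F

weakenLeaf : ∀ {k V} → Leaf k V → Leaf (suc k) V
weakenLeaf (atom A)  = atom A
weakenLeaf (sym P b) = sym (suc P) b
weakenLeaf (Xᵖ x)    = Xᵖ x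

weaken : ∀ {k} → FormulaSpec k → FormulaSpec (suc k)
weaken s = record { base = base ; rec = bindᶠ (leaf ∘ weakenLeaf) rec }
  where open FormulaSpec s

specᶠ : ∀ {k} → FormulaDefs k → Fin k → FormulaSpec k
specᶠ (D ▸ s) zero    = weaken s
specᶠ (D ▸ s) (suc P) = weaken (specᶠ D P)

evalLeaf : ∀ {k V} → (Fin k → ℕ → PropFormula) → (V → PropFormula) → ℕ → Leaf k V → PropFormula
evalLeaf σ ξ N (atom A)  = leaf (map₂ (_↓ᵃ N) A)
evalLeaf σ ξ N (sym P a) = σ P (a ↓ᵃ N)
evalLeaf σ ξ N (Xᵖ x)    = ξ x

evalᶠ : ∀ {k V} → (Fin k → ℕ → PropFormula) → (V → PropFormula) → ℕ → Formula (Leaf k V) → PropFormula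
evalᶠ σ ξ N = bindᶠ (evalLeaf σ ξ N)

unfoldᶠ : ∀ {k} → FormulaDefs k → Fin k → ℕ → PropFormula
unfoldᶠ (D ▸ s) zero    zero    = FormulaSpec.base s
unfoldᶠ (D ▸ s) zero    (suc N) = evalᶠ (unfoldᶠ D) (λ _ → unfoldᶠ (D ▸ s) zero N) N (FormulaSpec.rec s)
unfoldᶠ (D ▸ s) (suc P) N       = unfoldᶠ D P N

_⊨_↓ᶠ_ : ∀ {k} → FormulaDefs k → Schema k → ℕ → PropFormula
D ⊨ F ↓ᶠ N = evalᶠ (unfoldᶠ D) ⊥-elim N F

constant : ∀ {k} → PropFormula → Schema k
constant = bindᶠ (λ A → leaf (atom (map₂ numeral A)))

data Unfolding {k} (D : FormulaDefs k) : Rel (Schema k) 0ℓ where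
  at-zero : ∀ P → Unfolding D (leaf (sym P (numeral 0))) (constant (FormulaSpec.base (specᶠ D P)))
  at-suc  : ∀ P α β → Unfolding D
              (leaf (sym P (α ×n+ suc β)))
              ((FormulaSpec.rec (specᶠ D P) [ α ×n+ β ]ᶠ) [X↦ leaf (sym P (α ×n+ β)) ]ᶠ)

DefEq : ∀ {k} → FormulaDefs k → Rel (Schema k) 0ℓ
DefEq D = ReflClosure (SymClosure (Unfolding D))

SequentSchema : ℕ → Set
SequentSchema k = Sequent (Schema k)

_[_]ˢ : ∀ {k} → SequentSchema k → Arith → SequentSchema k
S [ a ]ˢ = mapˢ _[ a ]ᶠ S

_⊨_↓ˢ_ : ∀ {k} → FormulaDefs k → SequentSchema k → ℕ → Sequent PropFormula
D ⊨ S ↓ˢ N = mapˢ (D ⊨_↓ᶠ N) S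

-- Parametrised so as to cover both propositional proofs and proof schemata:
-- at embeds the atoms into the formula leaves, _~_ is the relation used by
-- the rule def, and Link S is the type of proof links with sequent S.
data LK {A L : Set} (at : A → L) (_~_ : Rel (Formula L) 0ℓ) (Link : Sequent (Formula L) → Set)
        : Sequent (Formula L) → Set where
  init : ∀ p → LK at _~_ Link ((leaf (at p) ∷ []) ⊢ (leaf (at p) ∷ []))
  link : ∀ {S} → Link S → LK at _~_ Link S

  def : ∀ {Γ Δ Γ′ Δ′} → Pointwise _~_ Γ Γ′ → Pointwise _~_ Δ Δ′ →
        LK at _~_ Link (Γ ⊢ Δ) → LK at _~_ Link (Γ′ ⊢ Δ′)

  w:l : ∀ {Γ Δ F} → LK at _~_ Link (Γ ⊢ Δ) → LK at _~_ Link ((F ∷ Γ) ⊢ Δ)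
  w:r : ∀ {Γ Δ F} → LK at _~_ Link (Γ ⊢ Δ) → LK at _~_ Link (Γ ⊢ (Δ ∷ʳ F))
  c:l : ∀ {Γ Δ F} → LK at _~_ Link ((F ∷ F ∷ Γ) ⊢ Δ) → LK at _~_ Link ((F ∷ Γ) ⊢ Δ)
  c:r : ∀ {Γ Δ F} → LK at _~_ Link (Γ ⊢ ((Δ ∷ʳ F) ∷ʳ F)) → LK at _~_ Link (Γ ⊢ (Δ ∷ʳ F))
  e:l : ∀ {Γ Π Δ F G} →
        LK at _~_ Link ((Γ ++ F ∷ G ∷ Π) ⊢ Δ) → LK at _~_ Link ((Γ ++ G ∷ F ∷ Π) ⊢ Δ)
  e:r : ∀ {Γ Δ Λ F G} →
        LK at _~_ Link (Γ ⊢ (Δ ++ F ∷ G ∷ Λ)) → LK at _~_ Link (Γ ⊢ (Δ ++ G ∷ F ∷ Λ))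

  cut : ∀ {Γ Δ Π Λ F} →
        LK at _~_ Link (Γ ⊢ (Δ ∷ʳ F)) → LK at _~_ Link ((F ∷ Π) ⊢ Λ) →
        LK at _~_ Link ((Γ ++ Π) ⊢ (Δ ++ Λ))

  ¬:l  : ∀ {Γ Δ F} → LK at _~_ Link (Γ ⊢ (Δ ∷ʳ F)) → LK at _~_ Link (((¬' F) ∷ Γ) ⊢ Δ)
  ¬:r  : ∀ {Γ Δ F} → LK at _~_ Link ((F ∷ Γ) ⊢ Δ) → LK at _~_ Link (Γ ⊢ (Δ ∷ʳ (¬' F)))
  ∧:l₁ : ∀ {Γ Δ F G} → LK at _~_ Link ((F ∷ Γ) ⊢ Δ) → LK at _~_ Link (((F ∧' G) ∷ Γ) ⊢ Δ)
  ∧:l₂ : ∀ {Γ Δ F G} → LK at _~_ Link ((G ∷ Γ) ⊢ Δ) → LK at _~_ Link (((F ∧' G) ∷ Γ) ⊢ Δ)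
  ∧:r  : ∀ {Γ Δ F G} →
         LK at _~_ Link (Γ ⊢ (Δ ∷ʳ F)) → LK at _~_ Link (Γ ⊢ (Δ ∷ʳ G)) →
         LK at _~_ Link (Γ ⊢ (Δ ∷ʳ (F ∧' G)))
  ∨:l  : ∀ {Γ Δ F G} →
         LK at _~_ Link ((F ∷ Γ) ⊢ Δ) → LK at _~_ Link ((G ∷ Γ) ⊢ Δ) →
         LK at _~_ Link (((F ∨' G) ∷ Γ) ⊢ Δ)
  ∨:r₁ : ∀ {Γ Δ F G} → LK at _~_ Link (Γ ⊢ (Δ ∷ʳ F)) → LK at _~_ Link (Γ ⊢ (Δ ∷ʳ (F ∨' G)))
  ∨:r₂ : ∀ {Γ Δ F G} → LK at _~_ Link (Γ ⊢ (Δ ∷ʳ G)) → LK at _~_ Link (Γ ⊢ (Δ ∷ʳ (F ∨' G)))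
  ⊃:l  : ∀ {Γ Δ Π Λ F G} →
         LK at _~_ Link (Γ ⊢ (Δ ∷ʳ F)) → LK at _~_ Link ((G ∷ Π) ⊢ Λ) →
         LK at _~_ Link (((F ⊃' G) ∷ Γ ++ Π) ⊢ (Δ ++ Λ))
  ⊃:r  : ∀ {Γ Δ F G} →
         LK at _~_ Link ((F ∷ Γ) ⊢ (Δ ∷ʳ G)) → LK at _~_ Link (Γ ⊢ (Δ ∷ʳ (F ⊃' G)))

-- On propositional formulas ↔def is the identity, and there are no links.
PropProof : Sequent PropFormula → Set
PropProof = LK id _≡_ (λ _ → ⊥)

-- Σ lists the end-sequents of the proof symbols in scope; Self S is the type
-- of links to the symbol being specified, with sequent S.
data Link {k} (Σ : List (SequentSchema k)) (Self : SequentSchema k → Set) : SequentSchema k → Set where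
  sym  : ∀ {S} → S ∈ Σ → (a : Arith) → Link Σ Self (S [ a ]ˢ)
  self : ∀ {S} → Self S → Link Σ Self S

Proof : ∀ {k} → FormulaDefs k → List (SequentSchema k) → (SequentSchema k → Set) → SequentSchema k → Set
Proof D Σ Self = LK atom (DefEq D) (Link Σ Self)

record ProofSpec {k} (D : FormulaDefs k) (Σ : List (SequentSchema k)) (S : SequentSchema k) : Set where
  field
    base : PropProof (D ⊨ S ↓ˢ 0)
    rec  : Proof D Σ (_≡ S) (S [ n+1 ]ˢ)

data ProofDefs {k} (D : FormulaDefs k) : List (SequentSchema k) → Set where
  []  : ProofDefs D []
  _▸_ : ∀ {Σ S} → ProofDefs D Σ → ProofSpec D Σ S → ProofDefs D (S ∷ Σ)

record ProofSchema : Set where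
  field
    {symbols}   : ℕ
    formulaDefs : FormulaDefs symbols
    {sequents}  : List (SequentSchema symbols)
    proofDefs   : ProofDefs formulaDefs sequents
    endSequent  : SequentSchema symbols
    proof       : Proof formulaDefs sequents (λ _ → ⊥) endSequent

infixl 6 _⊕_
infixl 7 _⊗_

data ClauseTerm (E R : Set) : Set where
  [_]     : Clause E → ClauseTerm E R
  ref     : R → ClauseTerm E R
  _⊕_ _⊗_ : ClauseTerm E R → ClauseTerm E R → ClauseTerm E R

GroundTerm : Set
GroundTerm = ClauseTerm ℕ ⊥

∣_∣ : GroundTerm → ClauseSet
∣ [ C ] ∣ = C ∷ []
∣ X ⊕ Y ∣ = ∣ X ∣ ++ ∣ Y ∣
∣ X ⊗ Y ∣ = ∣ X ∣ ×ᶜ ∣ Y ∣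

data TermRef (V Sym : Set) : Set where
  X : V → TermRef V Sym
  T : Sym → Arith → TermRef V Sym

-- A group of symbols, indexed by I, defined by mutual recursion in terms of
-- the symbols in Sym.  The characteristic terms use a finite I only.
record TermSpec (Sym I : Set) : Set where
  field
    base : I → GroundTerm
    rec  : I → ClauseTerm Arith (TermRef I Sym)

data TermDefs : Set → Set₁ where
  []  : TermDefs ⊥
  _▸_ : ∀ {Sym I} → TermDefs Sym → TermSpec Sym I → TermDefs (I ⊎ Sym)

record ClauseTermSchema : Set₁ where
  constructor termSchema
  field
    {Sym} : Set
    defs  : TermDefs Sym
    term  : ClauseTerm Arith (TermRef ⊥ Sym)

evalᵗ : ∀ {V Sym} → (Sym → ℕ → GroundTerm) → (V → GroundTerm) → ℕ →
        ClauseTerm Arith (TermRef V Sym) → GroundTerm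
evalᵗ τ ξ N [ C ]         = [ mapˢ (map₂ (_↓ᵃ N)) C ]
evalᵗ τ ξ N (ref (X x))   = ξ x
evalᵗ τ ξ N (ref (T t a)) = τ t (a ↓ᵃ N)
evalᵗ τ ξ N (t ⊕ u)       = evalᵗ τ ξ N t ⊕ evalᵗ τ ξ N u
evalᵗ τ ξ N (t ⊗ u)       = evalᵗ τ ξ N t ⊗ evalᵗ τ ξ N u

unfoldᵗ : ∀ {Sym} → TermDefs Sym → Sym → ℕ → GroundTerm
unfoldᵗ (D ▸ s) (inj₁ i) zero    = TermSpec.base s i
unfoldᵗ (D ▸ s) (inj₁ i) (suc N) = evalᵗ (unfoldᵗ D) (λ j → unfoldᵗ (D ▸ s) (inj₁ j) N) N (TermSpec.rec s i)
unfoldᵗ (D ▸ s) (inj₂ t) N       = unfoldᵗ D t N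

_↓ᵗ_ : ClauseTermSchema → ℕ → GroundTerm
termSchema D t ↓ᵗ N = evalᵗ (unfoldᵗ D) ⊥-elim N t

data Mark : Set where
  ■ □ : Mark

Marks : {A : Set} → List A → Set
Marks = All (λ _ → Mark)

Config : {A : Set} → Sequent A → Set
Config S = Marks (ant S) × Marks (con S)

∅ : {A : Set} (S : Sequent A) → Config S
∅ S = universal (λ _ → □) (ant S) , universal (λ _ → □) (con S)

tracked : {A : Set} {xs : List A} → Marks xs → List A
tracked []             = []
tracked (_∷_ {x} ■ ms) = x ∷ tracked ms
tracked (□ ∷ ms)       = tracked ms

_·_ : {A : Set} (S : Sequent A) → Config S → Sequent A
S · (l , r) = tracked l ⊢ tracked r

-- Configurations depend only on the shape of the sequent.
Config-map⁺ : {A B : Set} (f : A → B) (S : Sequent A) → Config S → Config (mapˢ f S)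
Config-map⁺ f S (l , r) = map⁺ l , map⁺ r

Config-map⁻ : {A B : Set} (f : A → B) (S : Sequent A) → Config (mapˢ f S) → Config S
Config-map⁻ f S (l , r) = map⁻ l , map⁻ r

copy : {A : Set} {_~_ : Rel A 0ℓ} {xs ys : List A} → Pointwise _~_ xs ys → Marks ys → Marks xs
copy []       []       = []
copy (_ ∷ ps) (m ∷ ms) = m ∷ copy ps ms

swap : {A : Set} (xs : List A) {x y : A} {zs : List A} → Marks (xs ++ y ∷ x ∷ zs) → Marks (xs ++ x ∷ y ∷ zs)
swap []       (m ∷ m′ ∷ ms) = m′ ∷ m ∷ ms
swap (_ ∷ xs) (m ∷ ms)      = m ∷ swap xs ms

lastMark : {A : Set} (xs : List A) {x : A} → Marks (xs ∷ʳ x) → Mark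
lastMark []       (m ∷ []) = m
lastMark (_ ∷ xs) (_ ∷ ms) = lastMark xs ms

_∷ʳᵐ_ : {A : Set} {xs : List A} {x : A} → Marks xs → Mark → Marks (xs ∷ʳ x)
ms ∷ʳᵐ m = ++⁺ ms (m ∷ [])

relast : {A : Set} (xs : List A) {x y : A} → Marks (xs ∷ʳ x) → Marks (xs ∷ʳ y)
relast xs ms = ++⁻ˡ xs ms ∷ʳᵐ lastMark xs ms

combine : {E R : Set} → Mark → ClauseTerm E R → ClauseTerm E R → ClauseTerm E R
combine ■ t u = t ⊕ u
combine □ t u = t ⊗ u

module _ {E L R : Set} {at : Atom E → L} {_~_ : Rel (Formula L) 0ℓ} {Link : Sequent (Formula L) → Set}
         (linkTerm : ∀ {S} → Link S → Config S → ClauseTerm E R) where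

  Θ : ∀ {S} → LK at _~_ Link S → Config S → ClauseTerm E R
  Θ (init p) (l ∷ [] , r ∷ [])            = [ ((p ∷ []) ⊢ (p ∷ [])) · (l ∷ [] , r ∷ []) ]
  Θ (link ℓ) Ω                            = linkTerm ℓ Ω
  Θ (def ps qs φ) (l , r)                 = Θ φ (copy ps l , copy qs r)
  Θ (w:l φ) (_ ∷ l , r)                   = Θ φ (l , r)
  Θ (w:r {Δ = Δ} φ) (l , r)               = Θ φ (l , ++⁻ˡ Δ r)
  Θ (c:l φ) (m ∷ l , r)                   = Θ φ (m ∷ m ∷ l , r)
  Θ (c:r {Δ = Δ} φ) (l , r)               = Θ φ (l , (r ∷ʳᵐ lastMark Δ r))
  Θ (e:l {Γ = Γ} φ) (l , r)               = Θ φ (swap Γ l , r)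
  Θ (e:r {Δ = Δ} φ) (l , r)               = Θ φ (l , swap Δ r)
  Θ (cut {Γ = Γ} {Δ = Δ} φ ψ) (l , r)     = Θ φ (++⁻ˡ Γ l , (++⁻ˡ Δ r ∷ʳᵐ ■)) ⊕ Θ ψ (■ ∷ ++⁻ʳ Γ l , ++⁻ʳ Δ r)
  Θ (¬:l φ) (m ∷ l , r)                   = Θ φ (l , (r ∷ʳᵐ m))
  Θ (¬:r {Δ = Δ} φ) (l , r)               = Θ φ (lastMark Δ r ∷ l , ++⁻ˡ Δ r)
  Θ (∧:l₁ φ) (m ∷ l , r)                  = Θ φ (m ∷ l , r)
  Θ (∧:l₂ φ) (m ∷ l , r)                  = Θ φ (m ∷ l , r)
  Θ (∧:r {Δ = Δ} φ ψ) (l , r)             = combine (lastMark Δ r) (Θ φ (l , relast Δ r)) (Θ ψ (l , relast Δ r))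
  Θ (∨:l φ ψ) (m ∷ l , r)                 = combine m (Θ φ (m ∷ l , r)) (Θ ψ (m ∷ l , r))
  Θ (∨:r₁ {Δ = Δ} φ) (l , r)              = Θ φ (l , relast Δ r)
  Θ (∨:r₂ {Δ = Δ} φ) (l , r)              = Θ φ (l , relast Δ r)
  Θ (⊃:l {Γ = Γ} {Δ = Δ} φ ψ) (m ∷ l , r) = combine m (Θ φ (++⁻ˡ Γ l , (++⁻ˡ Δ r ∷ʳᵐ m))) (Θ ψ (m ∷ ++⁻ʳ Γ l , ++⁻ʳ Δ r))
  Θ (⊃:r {Δ = Δ} φ) (l , r)               = Θ φ (lastMark Δ r ∷ l , relast Δ r)

-- The symbols Θ^Ω(ψ), for ψ a proof symbol and Ω a configuration of its end-sequent.
CharSym : ∀ {k} → List (SequentSchema k) → Set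
CharSym []      = ⊥
CharSym (S ∷ Σ) = Config S ⊎ CharSym Σ

charSym : ∀ {k} {Σ : List (SequentSchema k)} {S} → S ∈ Σ → Config S → CharSym Σ
charSym (here refl) Ω = inj₁ Ω
charSym (there i)   Ω = inj₂ (charSym i Ω)

charLink : ∀ {k V} {Σ : List (SequentSchema k)} {Self : SequentSchema k → Set} →
           (∀ {S} → Self S → Config S → V) →
           ∀ {S} → Link Σ Self S → Config S → ClauseTerm Arith (TermRef V (CharSym Σ))
charLink v (sym {S} i a) Ω = ref (T (charSym i (Config-map⁻ _[ a ]ᶠ S Ω)) a)
charLink v (self s)      Ω = ref (X (v s Ω))

charSpec : ∀ {k} {D : FormulaDefs k} {Σ S} → ProofSpec D Σ S → TermSpec (CharSym Σ) (Config S)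
charSpec {D = D} {S = S} ψ = record
  { base = λ Ω → Θ (λ ()) (ProofSpec.base ψ) (Config-map⁺ (D ⊨_↓ᶠ 0) S Ω)
  ; rec  = λ Ω → Θ (charLink (λ { refl Ω′ → Ω′ })) (ProofSpec.rec ψ) (Config-map⁺ _[ n+1 ]ᶠ S Ω)
  }

charDefs : ∀ {k} {D : FormulaDefs k} {Σ} → ProofDefs D Σ → TermDefs (CharSym Σ)
charDefs []       = []
charDefs (Ψ ▸ ψ) = charDefs Ψ ▸ charSpec ψ

characteristicTerm : ProofSchema → ClauseTermSchema
characteristicTerm φ = termSchema (charDefs proofDefs) (Θ (charLink (λ ())) proof (∅ endSequent))
  where open ProofSchema φ

AtomSetSchema : Set
AtomSetSchema = List (Atom Arith)

-- The duplicate-free list of the elements of 𝒜 ↓ N.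
_↓ˢᵉᵗ_ : AtomSetSchema → ℕ → List (Atom ℕ)
𝒜 ↓ˢᵉᵗ N = deduplicate _≟ᴬ_ (concatMap (λ (P , a) → map (P ,_) (upTo (suc (a ↓ᵃ N)))) 𝒜)

_IsAtomSetSchemaFor_ : AtomSetSchema → ClauseTermSchema → Set
𝒜 IsAtomSetSchemaFor t =
  ∀ N C → C ∈ ∣ t ↓ᵗ N ∣ → ∀ A → A ∈ ant C ⊎ A ∈ con C → A ∈ 𝒜 ↓ˢᵉᵗ N

emptyClause : Clause ℕ
emptyClause = [] ⊢ []

-- To be applied to duplicate-free lists only.
CLᵗ : List (Atom ℕ) → ClauseSet
CLᵗ = foldr (λ A 𝒞 → (((A ∷ []) ⊢ []) ∷ ([] ⊢ (A ∷ [])) ∷ []) ×ᶜ 𝒞) (emptyClause ∷ [])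

res : Clause ℕ → Clause ℕ → Atom ℕ → Clause ℕ
res (Γ ⊢ Δ) (Π ⊢ Λ) A = (Γ ++ remove Π) ⊢ (remove Δ ++ Λ)
  where
  remove : List (Atom ℕ) → List (Atom ℕ)
  remove = filter (λ B → ¬? (A ≟ᴬ B))

data Deduction : Set where
  clause : Clause ℕ → Deduction
  r      : Deduction → Deduction → Atom ℕ → Deduction

endClause : Deduction → Clause ℕ
endClause (clause C) = C
endClause (r γ δ A)  = res (endClause γ) (endClause δ) A

data _IsDeductionFrom_ : Deduction → ClauseSet → Set where
  clause : ∀ {𝒞 C} → C ∈ᶜ 𝒞 → clause C IsDeductionFrom 𝒞
  r      : ∀ {𝒞 γ δ A} → γ IsDeductionFrom 𝒞 → δ IsDeductionFrom 𝒞 → r γ δ A IsDeductionFrom 𝒞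

data WDeduction : Set where
  clause : Clause ℕ → WDeduction
  r      : WDeduction → WDeduction → Atom ℕ → WDeduction
  w      : WDeduction → Clause ℕ → WDeduction

endClauseʷ : WDeduction → Clause ℕ
endClauseʷ (clause C) = C
endClauseʷ (r γ δ A)  = res (endClauseʷ γ) (endClauseʷ δ) A
endClauseʷ (w γ D)    = endClauseʷ γ ∘ˢ D

data _IsWDeductionFrom_ : WDeduction → ClauseSet → Set where
  clause : ∀ {𝒞 C} → C ∈ᶜ 𝒞 → clause C IsWDeductionFrom 𝒞
  r      : ∀ {𝒞 γ δ A} → γ IsWDeductionFrom 𝒞 → δ IsWDeductionFrom 𝒞 → r γ δ A IsWDeductionFrom 𝒞
  w      : ∀ {𝒞 γ D} → γ IsWDeductionFrom 𝒞 → w γ D IsWDeductionFrom 𝒞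

-- cs lists the numbers of clause parameters of the defined clause symbols.
data ClauseSchema (E : Set) (cs : List ℕ) (V : Set) : Set where
  [_]  : Clause E → ClauseSchema E cs V
  X    : V → ClauseSchema E cs V
  _⊙_  : ClauseSchema E cs V → ClauseSchema E cs V → ClauseSchema E cs V
  call : ∀ {j} → j ∈ cs → E → Vector (ClauseSchema E cs V) j → ClauseSchema E cs V

-- In rec, the variable nothing stands for the value at n.
record ClauseSpec (cs : List ℕ) (j : ℕ) : Set where
  field
    base : ClauseSchema ℕ cs (Fin j)
    rec  : ClauseSchema Arith cs (Maybe (Fin j))

data ClauseDefs : List ℕ → Set where
  []  : ClauseDefs []
  _▸_ : ∀ {cs j} → ClauseDefs cs → ClauseSpec cs j → ClauseDefs (j ∷ cs)

ClauseFun : ℕ → Set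
ClauseFun j = Vector (Clause ℕ) j → Clause ℕ

evalᶜ : ∀ {E cs V} → (∀ {j} → j ∈ cs → ℕ → ClauseFun j) → (V → Clause ℕ) → (E → ℕ) →
        ClauseSchema E cs V → Clause ℕ
evalᶜ κ ξ e [ C ]         = mapˢ (map₂ e) C
evalᶜ κ ξ e (X x)         = ξ x
evalᶜ κ ξ e (C ⊙ D)       = evalᶜ κ ξ e C ∘ˢ evalᶜ κ ξ e D
evalᶜ κ ξ e (call c a Cs) = κ c (e a) (λ i → evalᶜ κ ξ e (Cs i))

unfoldᶜ : ∀ {cs} → ClauseDefs cs → ∀ {j} → j ∈ cs → ℕ → ClauseFun j
unfoldᶜ (D ▸ s) (here refl) zero    Xs = evalᶜ (unfoldᶜ D) Xs id (ClauseSpec.base s)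
unfoldᶜ (D ▸ s) (here refl) (suc N) Xs =
  evalᶜ (unfoldᶜ D) (maybe Xs (unfoldᶜ (D ▸ s) (here refl) N Xs)) (_↓ᵃ N) (ClauseSpec.rec s)
unfoldᶜ (D ▸ s) (there c)   N       Xs = unfoldᶜ D c N Xs

-- rs lists the numbers of clause parameters of the defined resolution proof
-- symbols; Self j is the type of recursive calls with j parameters.
data ResSchema (E : Set) (cs rs : List ℕ) (Self : ℕ → Set) (V : Set) : Set where
  clause : ClauseSchema E cs V → ResSchema E cs rs Self V
  r      : ResSchema E cs rs Self V → ResSchema E cs rs Self V → Atom E → ResSchema E cs rs Self V
  call   : ∀ {j} → j ∈ rs → E → Vector (ClauseSchema E cs V) j → ResSchema E cs rs Self V
  self   : ∀ {j} → Self j → Vector (ClauseSchema E cs V) j → ResSchema E cs rs Self V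

record ResSpec (cs rs : List ℕ) (j : ℕ) : Set where
  field
    base : ResSchema ℕ cs rs (λ _ → ⊥) (Fin j)
    rec  : ResSchema Arith cs rs (_≡ j) (Fin j)

data ResDefs (cs : List ℕ) : List ℕ → Set where
  []  : ResDefs cs []
  _▸_ : ∀ {rs j} → ResDefs cs rs → ResSpec cs rs j → ResDefs cs (j ∷ rs)

-- Closed: no clause variables and no recursive calls outside specifications.
record ResolutionProofSchema : Set where
  field
    {clauseArities} : List ℕ
    clauseDefs      : ClauseDefs clauseArities
    {resArities}    : List ℕ
    resDefs         : ResDefs clauseArities resArities
    schema          : ResSchema Arith clauseArities resArities (λ _ → ⊥) ⊥

DeductionFun : ℕ → Set
DeductionFun j = Vector (Clause ℕ) j → Deduction

evalʳ : ∀ {E cs rs Self V} → (∀ {j} → j ∈ cs → ℕ → ClauseFun j) → (∀ {j} → j ∈ rs → ℕ → DeductionFun j) →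
        (∀ {j} → Self j → DeductionFun j) → (V → Clause ℕ) → (E → ℕ) →
        ResSchema E cs rs Self V → Deduction
evalʳ κ ϱ σ ξ e (clause C)    = clause (evalᶜ κ ξ e C)
evalʳ κ ϱ σ ξ e (r γ δ A)     = r (evalʳ κ ϱ σ ξ e γ) (evalʳ κ ϱ σ ξ e δ) (map₂ e A)
evalʳ κ ϱ σ ξ e (call p a Cs) = ϱ p (e a) (λ i → evalᶜ κ ξ e (Cs i))
evalʳ κ ϱ σ ξ e (self s Cs)   = σ s (λ i → evalᶜ κ ξ e (Cs i))

unfoldʳ : ∀ {cs rs} → ClauseDefs cs → ResDefs cs rs → ∀ {j} → j ∈ rs → ℕ → DeductionFun j
unfoldʳ K (D ▸ s) (here refl) zero    Xs = evalʳ (unfoldᶜ K) (unfoldʳ K D) ⊥-elim Xs id (ResSpec.base s)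
unfoldʳ K (D ▸ s) (here refl) (suc N) Xs =
  evalʳ (unfoldᶜ K) (unfoldʳ K D) (λ i≡j → subst DeductionFun (≡.sym i≡j) (unfoldʳ K (D ▸ s) (here refl) N)) Xs (_↓ᵃ N) (ResSpec.rec s)
unfoldʳ K (D ▸ s) (there p)   N       Xs = unfoldʳ K D p N Xs

_↓ʳ_ : ResolutionProofSchema → ℕ → Deduction
ρ ↓ʳ N = evalʳ (unfoldᶜ clauseDefs) (unfoldʳ clauseDefs resDefs) ⊥-elim ⊥-elim (_↓ᵃ N) schema
  where open ResolutionProofSchema ρ

record RefutationSchema : Set₁ where
  field
    Θᴿ             : ClauseTermSchema
    𝒜              : AtomSetSchema
    ρ              : ResolutionProofSchema
    characteristic : ∃ λ φ → Θᴿ ≡ characteristicTerm φ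
    atomSet        : 𝒜 IsAtomSetSchemaFor Θᴿ
    deduction      : ∀ N → (ρ ↓ʳ N) IsDeductionFrom CLᵗ (𝒜 ↓ˢᵉᵗ N)
    refutation     : ∀ N → endClause (ρ ↓ʳ N) ≈ᶜ emptyClause

open RefutationSchema public

-- γ is obtained from a deduction by replacing each leaf D by w(C;D) for some
-- C ∈ 𝒞 subsuming D.
data WeakenedFrom (𝒞 : ClauseSet) : Deduction → WDeduction → Set where
  clause : ∀ {C D} → C ∈ᶜ 𝒞 → C ≤ᶜ D → WeakenedFrom 𝒞 (clause D) (w (clause C) D)
  r      : ∀ {γ δ γ′ δ′ A} → WeakenedFrom 𝒞 γ γ′ → WeakenedFrom 𝒞 δ δ′ →
           WeakenedFrom 𝒞 (r γ δ A) (r γ′ δ′ A)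

-- γ is a value of R ↓ N.  This is a relation because the choice of the
-- subsuming clauses is left open, and their existence is not built in.
_↓ᴿ_⇝_ : RefutationSchema → ℕ → WDeduction → Set
R ↓ᴿ N ⇝ γ = WeakenedFrom ∣ Θᴿ R ↓ᵗ N ∣ (ρ R ↓ʳ N) γ

{-# OPTIONS --safe #-}

-- If a valuation v falsifies the tracked part S·Ω of the end-sequent of φ, then
-- it falsifies some clause of Θ^Ω(φ): pass from the conclusion of each rule to a
-- premise with falsified tracked part, or to both premises where Θ has ⊗.  For
-- Ω = ∅ the hypothesis is void, so every valuation falsifies some clause of
-- |Θ ↓ N|.  A top clause D determines the valuation making exactly ant D true, and
-- a clause over 𝒜 ↓ N falsified by it subsumes D.
module Submission where

open import Defs

open import Data.Bool.Base using (Bool; true; false; not; _∧_; _∨_)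
open import Data.Bool.Properties
  using (∧-conicalˡ; ∧-conicalʳ; ∨-conicalˡ; ∨-conicalʳ; not-injective)
open import Data.Empty using (⊥; ⊥-elim)
open import Data.Fin.Base using (Fin; zero; suc)
open import Data.List.Base using (List; []; _∷_; _++_; _∷ʳ_; map)
open import Data.List.Membership.DecPropositional _≟ᴬ_ using (_∈?_)
open import Data.List.Membership.Propositional using (_∈_; find)
open import Data.List.Membership.Propositional.Properties
  using (∈-++⁺ˡ; ∈-++⁺ʳ; ∈-cartesianProductWith⁺; ∈-cartesianProductWith⁻)
open import Data.List.Relation.Binary.Permutation.Propositional using (↭-refl; ↭-sym)
open import Data.List.Relation.Binary.Permutation.Propositional.Properties using (∈-resp-↭)
open import Data.List.Relation.Binary.Pointwise.Base using (Pointwise; []; _∷_)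
open import Data.List.Relation.Unary.All using (All; []; _∷_; lookup)
import Data.List.Relation.Unary.All as All
import Data.List.Relation.Unary.All.Properties as All
open import Data.List.Relation.Unary.Any using (here; there)
import Data.List.Relation.Unary.Any as Any
open import Data.Nat.Base using (ℕ; zero; suc; _+_; _*_)
open import Data.Nat.Properties using (+-suc; +-comm; *-identityˡ)
open import Data.Nat.Tactic.RingSolver using (solve-∀)
open import Data.Product.Base using (_×_; _,_; ∃; proj₁; proj₂; map₂)
import Data.Product.Base as Product
open import Data.Sum.Base using (_⊎_; inj₁; inj₂; [_,_]′)
import Data.Sum.Base as Sum
open import Data.Unit.Base using (⊤; tt)
open import Function.Base using (_∘_; id)
open import Level using (0ℓ)
open import Relation.Binary.Construct.Closure.Reflexive using (refl; [_])
open import Relation.Binary.Construct.Closure.Symmetric using (fwd; bwd)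
open import Relation.Binary.Core using (Rel)
open import Relation.Binary.PropositionalEquality
  using (_≡_; refl; trans; cong; cong₂; module ≡-Reasoning)
import Relation.Binary.PropositionalEquality as ≡
open import Relation.Nullary.Decidable.Core using (does; yes; no)

-- Boolean semantics and substitution in formulas

⟦_⟧ : {A : Set} → Formula A → (A → Bool) → Bool
⟦ leaf a ⟧ v = v a
⟦ ¬' F ⟧   v = not (⟦ F ⟧ v)
⟦ F ∧' G ⟧ v = ⟦ F ⟧ v ∧ ⟦ G ⟧ v
⟦ F ∨' G ⟧ v = ⟦ F ⟧ v ∨ ⟦ G ⟧ v
⟦ F ⊃' G ⟧ v = not (⟦ F ⟧ v) ∨ ⟦ G ⟧ v

module _ {A B : Set} where

  bindᶠ-cong : {f g : A → Formula B} → (∀ a → f a ≡ g a) → ∀ F → bindᶠ f F ≡ bindᶠ g F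
  bindᶠ-cong f≗g (leaf a) = f≗g a
  bindᶠ-cong f≗g (¬' F)   = cong ¬'_ (bindᶠ-cong f≗g F)
  bindᶠ-cong f≗g (F ∧' G) = cong₂ _∧'_ (bindᶠ-cong f≗g F) (bindᶠ-cong f≗g G)
  bindᶠ-cong f≗g (F ∨' G) = cong₂ _∨'_ (bindᶠ-cong f≗g F) (bindᶠ-cong f≗g G)
  bindᶠ-cong f≗g (F ⊃' G) = cong₂ _⊃'_ (bindᶠ-cong f≗g F) (bindᶠ-cong f≗g G)

  -- Since evaluation of a schema is a `bindᶠ`, this trades evaluating the formula for a suitable
  -- valuation of its leaves. A proof schema can then be treated without unfolding the formulas in
  -- it.
  ⟦bindᶠ⟧ : (f : A → Formula B) (v : B → Bool) → ∀ F → ⟦ bindᶠ f F ⟧ v ≡ ⟦ F ⟧ (λ a → ⟦ f a ⟧ v)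
  ⟦bindᶠ⟧ f v (leaf a) = refl
  ⟦bindᶠ⟧ f v (¬' F)   = cong not (⟦bindᶠ⟧ f v F)
  ⟦bindᶠ⟧ f v (F ∧' G) = cong₂ _∧_ (⟦bindᶠ⟧ f v F) (⟦bindᶠ⟧ f v G)
  ⟦bindᶠ⟧ f v (F ∨' G) = cong₂ _∨_ (⟦bindᶠ⟧ f v F) (⟦bindᶠ⟧ f v G)
  ⟦bindᶠ⟧ f v (F ⊃' G) = cong₂ (λ x y → not x ∨ y) (⟦bindᶠ⟧ f v F) (⟦bindᶠ⟧ f v G)

bindᶠ-bindᶠ : {A B C : Set} (g : B → Formula C) (f : A → Formula B) →
              ∀ F → bindᶠ g (bindᶠ f F) ≡ bindᶠ (bindᶠ g ∘ f) F
bindᶠ-bindᶠ g f (leaf a) = refl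
bindᶠ-bindᶠ g f (¬' F)   = cong ¬'_ (bindᶠ-bindᶠ g f F)
bindᶠ-bindᶠ g f (F ∧' G) = cong₂ _∧'_ (bindᶠ-bindᶠ g f F) (bindᶠ-bindᶠ g f G)
bindᶠ-bindᶠ g f (F ∨' G) = cong₂ _∨'_ (bindᶠ-bindᶠ g f F) (bindᶠ-bindᶠ g f G)
bindᶠ-bindᶠ g f (F ⊃' G) = cong₂ _⊃'_ (bindᶠ-bindᶠ g f F) (bindᶠ-bindᶠ g f G)

bindᶠ-leaf : {A : Set} (F : Formula A) → bindᶠ leaf F ≡ F
bindᶠ-leaf (leaf a) = refl
bindᶠ-leaf (¬' F)   = cong ¬'_ (bindᶠ-leaf F)
bindᶠ-leaf (F ∧' G) = cong₂ _∧'_ (bindᶠ-leaf F) (bindᶠ-leaf G)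
bindᶠ-leaf (F ∨' G) = cong₂ _∨'_ (bindᶠ-leaf F) (bindᶠ-leaf G)
bindᶠ-leaf (F ⊃' G) = cong₂ _⊃'_ (bindᶠ-leaf F) (bindᶠ-leaf G)

-- Evaluation of schemata

↓ᵃ-[]ᵃ : ∀ a b N → (a [ b ]ᵃ) ↓ᵃ N ≡ a ↓ᵃ (b ↓ᵃ N)
↓ᵃ-[]ᵃ (α ×n+ β) (γ ×n+ δ) = lemma α β γ δ
  where
  lemma : ∀ α β γ δ N → α * γ * N + (α * δ + β) ≡ α * (γ * N + δ) + β
  lemma = solve-∀

n+1-↓ᵃ : ∀ N → n+1 ↓ᵃ N ≡ suc N
n+1-↓ᵃ N = trans (+-comm (1 * N) 1) (cong suc (*-identityˡ N))

module _ {k : ℕ} {V : Set} (σ : Fin k → ℕ → PropFormula) (ξ : V → PropFormula) (N : ℕ) where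

  evalᶠ-[]ᶠ : ∀ a F → evalᶠ σ ξ N (F [ a ]ᶠ) ≡ evalᶠ σ ξ (a ↓ᵃ N) F
  evalᶠ-[]ᶠ a F = trans (bindᶠ-bindᶠ _ _ F) (bindᶠ-cong evalLeaf-substLeaf F)
    where
    evalLeaf-substLeaf : ∀ l → evalLeaf σ ξ N (substLeaf a l) ≡ evalLeaf σ ξ (a ↓ᵃ N) l
    evalLeaf-substLeaf (atom (P , b)) = cong (λ M → leaf (P , M)) (↓ᵃ-[]ᵃ b a N)
    evalLeaf-substLeaf (sym P b)      = cong (σ P) (↓ᵃ-[]ᵃ b a N)
    evalLeaf-substLeaf (Xᵖ x)         = refl

  evalᶠ-[X↦] : ∀ F G → evalᶠ σ ξ N (F [X↦ G ]ᶠ) ≡ evalᶠ σ (λ _ → evalᶠ σ ξ N G) N F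
  evalᶠ-[X↦] F G = trans (bindᶠ-bindᶠ _ _ F) (bindᶠ-cong evalᶠ-fillLeaf F)
    where
    evalᶠ-fillLeaf : ∀ l → evalᶠ σ ξ N (fillLeaf G l) ≡ evalLeaf σ (λ _ → evalᶠ σ ξ N G) N l
    evalᶠ-fillLeaf (atom A)  = refl
    evalᶠ-fillLeaf (sym P b) = refl
    evalᶠ-fillLeaf (Xᵖ x)    = refl

evalᶠ-constant : ∀ {k} (σ : Fin k → ℕ → PropFormula) ξ N F → evalᶠ σ ξ N (constant F) ≡ F
evalᶠ-constant σ ξ N F = trans (bindᶠ-bindᶠ _ _ F) (bindᶠ-leaf F)

evalᶠ-weaken : ∀ {k V} (D : FormulaDefs k) s (ξ : V → PropFormula) N F →
               evalᶠ (unfoldᶠ (D ▸ s)) ξ N (bindᶠ (leaf ∘ weakenLeaf) F) ≡ evalᶠ (unfoldᶠ D) ξ N F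
evalᶠ-weaken D s ξ N F = trans (bindᶠ-bindᶠ _ _ F) (bindᶠ-cong evalLeaf-weakenLeaf F)
  where
  evalLeaf-weakenLeaf : ∀ l → evalLeaf (unfoldᶠ (D ▸ s)) ξ N (weakenLeaf l) ≡ evalLeaf (unfoldᶠ D) ξ N l
  evalLeaf-weakenLeaf (atom A)  = refl
  evalLeaf-weakenLeaf (sym P b) = refl
  evalLeaf-weakenLeaf (Xᵖ x)    = refl

unfoldᶠ-zero : ∀ {k} (D : FormulaDefs k) P → unfoldᶠ D P 0 ≡ FormulaSpec.base (specᶠ D P)
unfoldᶠ-zero (D ▸ s) zero    = refl
unfoldᶠ-zero (D ▸ s) (suc P) = unfoldᶠ-zero D P

-- `unfoldᶠ` evaluates a specification in the scope where it was made, while `specᶠ` reads it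
-- weakened to the full scope; `evalᶠ-weaken` reconciles the two.
unfoldᶠ-suc : ∀ {k} (D : FormulaDefs k) P N →
              unfoldᶠ D P (suc N) ≡ evalᶠ (unfoldᶠ D) (λ _ → unfoldᶠ D P N) N (FormulaSpec.rec (specᶠ D P))
unfoldᶠ-suc (D ▸ s) zero    N = ≡.sym (evalᶠ-weaken D s _ N (FormulaSpec.rec s))
unfoldᶠ-suc (D ▸ s) (suc P) N =
  trans (unfoldᶠ-suc D P N) (≡.sym (evalᶠ-weaken D s _ N (FormulaSpec.rec (specᶠ D P))))

module _ {k : ℕ} (D : FormulaDefs k) (N : ℕ) where

  -- An argument with offset `suc β` evaluates to a successor whatever the parameter is, so the
  -- recursive clause applies and both sides unfold to the same propositional formula.
  Unfolding-sound : ∀ {F G} → Unfolding D F G → D ⊨ F ↓ᶠ N ≡ D ⊨ G ↓ᶠ N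
  Unfolding-sound (at-zero P) = trans (unfoldᶠ-zero D P) (≡.sym (evalᶠ-constant _ _ N _))
  Unfolding-sound (at-suc P α β) = begin
    unfoldᶠ D P (α * N + suc β)                    ≡⟨ cong (unfoldᶠ D P) (+-suc (α * N) β) ⟩
    unfoldᶠ D P (suc (a ↓ᵃ N))                     ≡⟨ unfoldᶠ-suc D P (a ↓ᵃ N) ⟩
    evalᶠ (unfoldᶠ D) predecessor (a ↓ᵃ N) F       ≡⟨ evalᶠ-[]ᶠ _ _ N a F ⟨
    evalᶠ (unfoldᶠ D) predecessor N (F [ a ]ᶠ)     ≡⟨ evalᶠ-[X↦] _ _ N (F [ a ]ᶠ) _ ⟨
    D ⊨ (F [ a ]ᶠ) [X↦ leaf (sym P a) ]ᶠ ↓ᶠ N      ∎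
    where
    open ≡-Reasoning
    a = α ×n+ β
    F = FormulaSpec.rec (specᶠ D P)
    -- The value of the variable is already taken at `a ↓ᵃ N`, so substituting `a` for the parameter
    -- does not touch it, and it agrees with the value at `N` of the formula put for the variable.
    predecessor : ⊤ → PropFormula
    predecessor _ = unfoldᶠ D P (a ↓ᵃ N)

  DefEq-sound : ∀ {F G} → DefEq D F G → D ⊨ F ↓ᶠ N ≡ D ⊨ G ↓ᶠ N
  DefEq-sound refl        = refl
  DefEq-sound [ fwd F→G ] = Unfolding-sound F→G
  DefEq-sound [ bwd G→F ] = ≡.sym (Unfolding-sound G→F)

-- Tracked formulas

-- The truth value of a formula occurrence is known, and has to be supplied, only if the occurrence
-- is tracked. With this type a rule can be treated uniformly in the mark of its principal formula.
When : Mark → Set → Set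
When ■ A = A
When □ A = ⊤

When-map : ∀ m {A B : Set} → (A → B) → When m A → When m B
When-map ■ f a = f a
When-map □ f _ = tt

module _ {A : Set} {P : A → Set} where

  cons-tracked : ∀ m {x xs} {ms : Marks xs} → When m (P x) → All P (tracked ms) →
                 All P (tracked (_∷_ {x = x} m ms))
  cons-tracked ■ p ps = p ∷ ps
  cons-tracked □ _ ps = ps

  uncons-tracked : ∀ m {x xs} {ms : Marks xs} → All P (tracked (_∷_ {x = x} m ms)) →
                   When m (P x) × All P (tracked ms)
  uncons-tracked ■ (p ∷ ps) = p , ps
  uncons-tracked □ ps       = tt , ps

  snoc-tracked : ∀ {xs x} (ms : Marks xs) m → All P (tracked ms) → When m (P x) →
                 All P (tracked (_∷ʳᵐ_ {x = x} ms m))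
  snoc-tracked []       m ps p = cons-tracked m p []
  snoc-tracked (n ∷ ms) m ps p =
    let q , qs = uncons-tracked n ps in cons-tracked n q (snoc-tracked ms m qs p)

  split-tracked : ∀ xs {ys} (ms : Marks (xs ++ ys)) → All P (tracked ms) →
                  All P (tracked (All.++⁻ˡ xs ms)) × All P (tracked (All.++⁻ʳ xs ms))
  split-tracked []       ms       ps = [] , ps
  split-tracked (x ∷ xs) (m ∷ ms) ps =
    let q , qs = uncons-tracked m ps
    in Product.map₁ (cons-tracked m q) (split-tracked xs ms qs)

  last-tracked : ∀ xs {x} (ms : Marks (xs ∷ʳ x)) → All P (tracked ms) → When (lastMark xs ms) (P x)
  last-tracked []       (m ∷ []) ps = proj₁ (uncons-tracked m ps)
  last-tracked (x ∷ xs) (m ∷ ms) ps = last-tracked xs ms (proj₂ (uncons-tracked m ps))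

  relast-tracked : ∀ xs {x y} (ms : Marks (xs ∷ʳ x)) → (P x → P y) → All P (tracked ms) →
                   All P (tracked (relast xs {y = y} ms))
  relast-tracked xs ms f ps =
    snoc-tracked (All.++⁻ˡ xs ms) _ (proj₁ (split-tracked xs ms ps))
      (When-map (lastMark xs ms) f (last-tracked xs ms ps))

  swap-tracked : ∀ xs {x y zs} (ms : Marks (xs ++ y ∷ x ∷ zs)) → All P (tracked ms) →
                 All P (tracked (swap xs ms))
  swap-tracked []       (m ∷ m′ ∷ ms) ps =
    let p , qs = uncons-tracked m ps
        q , rs = uncons-tracked m′ qs
    in cons-tracked m′ q (cons-tracked m p rs)
  swap-tracked (x ∷ xs) (m ∷ ms)      ps =
    let p , qs = uncons-tracked m ps in cons-tracked m p (swap-tracked xs ms qs)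

  copy-tracked : ∀ {_~_ : Rel A 0ℓ} {xs ys} → (∀ {x y} → x ~ y → P y → P x) →
                 (es : Pointwise _~_ xs ys) (ms : Marks ys) → All P (tracked ms) →
                 All P (tracked (copy es ms))
  copy-tracked f []       []       ps = []
  copy-tracked f (e ∷ es) (m ∷ ms) ps =
    let q , qs = uncons-tracked m ps
    in cons-tracked m (When-map m (f e) q) (copy-tracked f es ms qs)

  ∅-tracked : ∀ xs → All P (tracked (All.universal (λ _ → □) xs))
  ∅-tracked []       = []
  ∅-tracked (x ∷ xs) = ∅-tracked xs

module _ {A B : Set} {P : A → Set} {Q : B → Set} (f : A → B) where

  tracked-map⁺ : (∀ {x} → P x → Q (f x)) → ∀ {xs} (ms : Marks xs) → All P (tracked ms) →
                 All Q (tracked (All.map⁺ {f = f} ms))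
  tracked-map⁺ g []       ps = []
  tracked-map⁺ g (m ∷ ms) ps =
    let q , qs = uncons-tracked m ps
    in cons-tracked m (When-map m g q) (tracked-map⁺ g ms qs)

  tracked-map⁻ : (∀ {x} → Q (f x) → P x) → ∀ xs (ms : Marks (map f xs)) →
                 All Q (tracked ms) → All P (tracked (All.map⁻ {f = f} ms))
  tracked-map⁻ g []       []       ps = []
  tracked-map⁻ g (x ∷ xs) (m ∷ ms) ps =
    let q , qs = uncons-tracked m ps
    in cons-tracked m (When-map m g q) (tracked-map⁻ g xs ms qs)

-- The entries have any type, so that formula sequents and clauses share one notion; `t` gives the
-- truth value of an entry.
Falsified : {A : Set} → (A → Bool) → Sequent A → Set
Falsified t (Γ ⊢ Δ) = All (λ x → t x ≡ true) Γ × All (λ x → t x ≡ false) Δ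

Falsified-cong : {A : Set} {t u : A → Bool} → (∀ x → t x ≡ u x) → ∀ {S} → Falsified t S → Falsified u S
Falsified-cong t≗u = Product.map (All.map (trans (≡.sym (t≗u _)))) (All.map (trans (≡.sym (t≗u _))))

module _ {A B : Set} {t : A → Bool} {u : B → Bool} (f : A → B) (t≗u : ∀ x → t x ≡ u (f x)) where

  -- Serves the proofs in a specification: their end-sequents are images of `S`, under evaluation at
  -- 0 or substitution of `n+1`, whereas the configuration is given on `S`.
  Falsified-map⁺ : ∀ S (Ω : Config S) → Falsified t (S · Ω) →
                   Falsified u (mapˢ f S · Config-map⁺ f S Ω)
  Falsified-map⁺ S (ls , rs) (ps , qs) =
    tracked-map⁺ f (trans (≡.sym (t≗u _))) ls ps , tracked-map⁺ f (trans (≡.sym (t≗u _))) rs qs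

  -- Serves links to earlier symbols: the configuration is given on the instance `S [ a ]ˢ` and has
  -- to be carried back to `S`.
  Falsified-map⁻ : ∀ S (Ω : Config (mapˢ f S)) → Falsified u (mapˢ f S · Ω) →
                   Falsified t (S · Config-map⁻ f S Ω)
  Falsified-map⁻ (Γ ⊢ Δ) (ls , rs) (ps , qs) =
    tracked-map⁻ f (trans (t≗u _)) Γ ls ps , tracked-map⁻ f (trans (t≗u _)) Δ rs qs

-- Characteristic terms

-- The clause set denoted by the term contains a clause falsified by v, given
-- that those denoted by the references satisfying Q do.
data Refuted {E R : Set} (v : Atom E → Bool) (Q : R → Set) : ClauseTerm E R → Set where
  clause : ∀ {C} → Falsified v C → Refuted v Q [ C ]
  ref    : ∀ {x} → Q x → Refuted v Q (ref x)
  ⊕ˡ     : ∀ {t u} → Refuted v Q t → Refuted v Q (t ⊕ u)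
  ⊕ʳ     : ∀ {t u} → Refuted v Q u → Refuted v Q (t ⊕ u)
  _⊗_    : ∀ {t u} → Refuted v Q t → Refuted v Q u → Refuted v Q (t ⊗ u)

-- A tracked principal formula has a known value, which falsifies one of the premises, and one
-- summand suffices for `⊕`. If it is untracked, so are the auxiliary formulas; nothing has to be
-- shown of them, and both premises are available for `⊗`.
refuted-combine : ∀ {E R} {v : Atom E → Bool} {Q : R → Set} m {t u} {A B C : Set} →
                  When m A → (A → B ⊎ C) → (When m B → Refuted v Q t) → (When m C → Refuted v Q u) →
                  Refuted v Q (combine m t u)
refuted-combine ■ a f g h = [ ⊕ˡ ∘ g , ⊕ʳ ∘ h ]′ (f a)
refuted-combine □ _ _ g h = g tt ⊗ h tt

∧≡false : ∀ x y → x ∧ y ≡ false → x ≡ false ⊎ y ≡ false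
∧≡false true  y p = inj₂ p
∧≡false false y p = inj₁ refl

∨≡true : ∀ x y → x ∨ y ≡ true → x ≡ true ⊎ y ≡ true
∨≡true true  y p = inj₁ refl
∨≡true false y p = inj₂ p

≡false⊎≡true : ∀ x → x ≡ false ⊎ x ≡ true
≡false⊎≡true false = inj₁ refl
≡false⊎≡true true  = inj₂ refl

module _ {E L R : Set} {at : Atom E → L} {_~_ : Rel (Formula L) 0ℓ} {Link : Sequent (Formula L) → Set}
         {linkTerm : ∀ {S} → Link S → Config S → ClauseTerm E R} {Q : R → Set} (t : L → Bool)
         (~-sound : ∀ {F G} → F ~ G → ⟦ F ⟧ t ≡ ⟦ G ⟧ t)
         (link-refuted : ∀ {S} (ℓ : Link S) Ω → Falsified (λ F → ⟦ F ⟧ t) (S · Ω) →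
                         Refuted (t ∘ at) Q (linkTerm ℓ Ω)) where

  -- Induction on `φ`. The valuation `t` is one of formula leaves, so defined symbols have truth
  -- values too; only its restriction along `at` matters for the clauses of the term.
  Θ-refuted : ∀ {S} (φ : LK at _~_ Link S) Ω → Falsified (λ F → ⟦ F ⟧ t) (S · Ω) →
              Refuted (t ∘ at) Q (Θ linkTerm φ Ω)
  -- The clause here is the tracked part itself, so the hypothesis is the conclusion; splitting on
  -- the marks lets both reduce.
  Θ-refuted (init p) (■ ∷ [] , ■ ∷ []) (x ∷ [] , y ∷ []) = clause (x ∷ [] , y ∷ [])
  Θ-refuted (init p) (■ ∷ [] , □ ∷ []) (x ∷ [] , [])     = clause (x ∷ [] , [])
  Θ-refuted (init p) (□ ∷ [] , ■ ∷ []) ([] , y ∷ [])     = clause ([] , y ∷ [])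
  Θ-refuted (init p) (□ ∷ [] , □ ∷ []) ([] , [])         = clause ([] , [])
  Θ-refuted (link ℓ) Ω ps = link-refuted ℓ Ω ps
  Θ-refuted (def es fs φ) (ls , rs) (ps , qs) =
    Θ-refuted φ _ (copy-tracked (trans ∘ ~-sound) es ls ps , copy-tracked (trans ∘ ~-sound) fs rs qs)
  Θ-refuted (w:l φ) (m ∷ ls , rs) (ps , qs) = Θ-refuted φ _ (proj₂ (uncons-tracked m ps) , qs)
  Θ-refuted (w:r {Δ = Δ} φ) (ls , rs) (ps , qs) = Θ-refuted φ _ (ps , proj₁ (split-tracked Δ rs qs))
  Θ-refuted (c:l φ) (m ∷ ls , rs) (ps , qs) =
    Θ-refuted φ _ (cons-tracked m (proj₁ (uncons-tracked m ps)) ps , qs)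
  Θ-refuted (c:r {Δ = Δ} φ) (ls , rs) (ps , qs) =
    Θ-refuted φ _ (ps , snoc-tracked rs _ qs (last-tracked Δ rs qs))
  Θ-refuted (e:l {Γ = Γ} φ) (ls , rs) (ps , qs) = Θ-refuted φ _ (swap-tracked Γ ls ps , qs)
  Θ-refuted (e:r {Δ = Δ} φ) (ls , rs) (ps , qs) = Θ-refuted φ _ (ps , swap-tracked Δ rs qs)
  Θ-refuted (cut {Γ = Γ} {Δ = Δ} {F = F} φ ψ) (ls , rs) (ps , qs) =
    let ps₁ , ps₂ = split-tracked Γ ls ps
        qs₁ , qs₂ = split-tracked Δ rs qs
    -- Both cut formulas are tracked and the term is a sum for every configuration; the value of `F`
    -- under `t` selects the premise.
    in refuted-combine ■ tt (λ _ → ≡false⊎≡true (⟦ F ⟧ t))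
         (λ f → Θ-refuted φ _ (ps₁ , snoc-tracked (All.++⁻ˡ Δ rs) ■ qs₁ f))
         (λ f → Θ-refuted ψ _ (f ∷ ps₂ , qs₂))
  Θ-refuted (¬:l φ) (m ∷ ls , rs) (ps , qs) =
    let p , ps′ = uncons-tracked m ps
    in Θ-refuted φ _ (ps′ , snoc-tracked rs m qs (When-map m not-injective p))
  Θ-refuted (¬:r {Δ = Δ} φ) (ls , rs) (ps , qs) =
    Θ-refuted φ _ ( cons-tracked _ (When-map (lastMark Δ rs) not-injective (last-tracked Δ rs qs)) ps
                  , proj₁ (split-tracked Δ rs qs))
  Θ-refuted (∧:l₁ φ) (m ∷ ls , rs) (ps , qs) =
    let p , ps′ = uncons-tracked m ps
    in Θ-refuted φ _ (cons-tracked m (When-map m (∧-conicalˡ _ _) p) ps′ , qs)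
  Θ-refuted (∧:l₂ φ) (m ∷ ls , rs) (ps , qs) =
    let p , ps′ = uncons-tracked m ps
    in Θ-refuted φ _ (cons-tracked m (When-map m (∧-conicalʳ _ _) p) ps′ , qs)
  Θ-refuted (∧:r {Δ = Δ} φ ψ) (ls , rs) (ps , qs) =
    let qs′ = proj₁ (split-tracked Δ rs qs)
    in refuted-combine (lastMark Δ rs) (last-tracked Δ rs qs) (∧≡false _ _)
         (λ f → Θ-refuted φ _ (ps , snoc-tracked (All.++⁻ˡ Δ rs) _ qs′ f))
         (λ g → Θ-refuted ψ _ (ps , snoc-tracked (All.++⁻ˡ Δ rs) _ qs′ g))
  Θ-refuted (∨:l φ ψ) (m ∷ ls , rs) (ps , qs) =
    let p , ps′ = uncons-tracked m ps
    in refuted-combine m p (∨≡true _ _)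
         (λ f → Θ-refuted φ _ (cons-tracked m f ps′ , qs))
         (λ g → Θ-refuted ψ _ (cons-tracked m g ps′ , qs))
  Θ-refuted (∨:r₁ {Δ = Δ} φ) (ls , rs) (ps , qs) =
    Θ-refuted φ _ (ps , relast-tracked Δ rs (∨-conicalˡ _ _) qs)
  Θ-refuted (∨:r₂ {Δ = Δ} φ) (ls , rs) (ps , qs) =
    Θ-refuted φ _ (ps , relast-tracked Δ rs (∨-conicalʳ _ _) qs)
  Θ-refuted (⊃:l {Γ = Γ} {Δ = Δ} φ ψ) (m ∷ ls , rs) (ps , qs) =
    let p , ps′   = uncons-tracked m ps
        ps₁ , ps₂ = split-tracked Γ ls ps′
        qs₁ , qs₂ = split-tracked Δ rs qs
    in refuted-combine m p (Sum.map₁ not-injective ∘ ∨≡true _ _)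
         (λ f → Θ-refuted φ _ (ps₁ , snoc-tracked (All.++⁻ˡ Δ rs) m qs₁ f))
         (λ g → Θ-refuted ψ _ (cons-tracked m g ps₂ , qs₂))
  Θ-refuted (⊃:r {Δ = Δ} φ) (ls , rs) (ps , qs) =
    Θ-refuted φ _
      ( cons-tracked _ (When-map (lastMark Δ rs) (not-injective ∘ ∨-conicalˡ _ _) (last-tracked Δ rs qs)) ps
      , relast-tracked Δ rs (∨-conicalʳ _ _) qs)

GroundRefuted : (Atom ℕ → Bool) → GroundTerm → Set
GroundRefuted v = Refuted v ⊥-elim

-- Evaluation keeps the shape of a term except at references, and there the chosen predicate is the
-- required conclusion itself.
evalᵗ-refuted : ∀ {V Sym} {v : Atom ℕ → Bool} {τ : Sym → ℕ → GroundTerm} {ξ : V → GroundTerm} {N} {t} →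
                Refuted (v ∘ map₂ (_↓ᵃ N)) (GroundRefuted v ∘ evalᵗ τ ξ N ∘ ref) t →
                GroundRefuted v (evalᵗ τ ξ N t)
evalᵗ-refuted (clause (ps , qs)) = clause (All.map⁺ ps , All.map⁺ qs)
evalᵗ-refuted (ref {x} p)        = p
evalᵗ-refuted (⊕ˡ p)             = ⊕ˡ (evalᵗ-refuted p)
evalᵗ-refuted (⊕ʳ p)             = ⊕ʳ (evalᵗ-refuted p)
evalᵗ-refuted (p ⊗ q)            = evalᵗ-refuted p ⊗ evalᵗ-refuted q

falsified-clause : ∀ {v t} → GroundRefuted v t → ∃ λ C → C ∈ ∣ t ∣ × Falsified v C
falsified-clause (clause p) = _ , here refl , p
falsified-clause (⊕ˡ p)     = let C , C∈ , f = falsified-clause p in C , ∈-++⁺ˡ C∈ , f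
falsified-clause (⊕ʳ p)     = let C , C∈ , f = falsified-clause p in C , ∈-++⁺ʳ _ C∈ , f
falsified-clause (p ⊗ q)    =
  let C , C∈ , ps , qs = falsified-clause p
      D , D∈ , rs , ss = falsified-clause q
  in C ∘ˢ D , ∈-cartesianProductWith⁺ _∘ˢ_ C∈ D∈ , All.++⁺ ps rs , All.++⁺ qs ss

-- Semantics of proof schemata

module _ {k : ℕ} (D : FormulaDefs k) (v : Atom ℕ → Bool) where

  truth : ℕ → Schema k → Bool
  truth N F = ⟦ D ⊨ F ↓ᶠ N ⟧ v

  -- A defined symbol gets the truth value of its unfolding. This is the valuation under which
  -- `Θ-refuted` is applied to proof schemata.
  leafTruth : ℕ → Leaf k ⊥ → Bool
  leafTruth N l = ⟦ evalLeaf (unfoldᶠ D) ⊥-elim N l ⟧ v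

  truth-leafTruth : ∀ N F → truth N F ≡ ⟦ F ⟧ (leafTruth N)
  truth-leafTruth N = ⟦bindᶠ⟧ _ v

  truth-[]ᶠ : ∀ N a F → truth (a ↓ᵃ N) F ≡ truth N (F [ a ]ᶠ)
  truth-[]ᶠ N a F = cong (λ G → ⟦ G ⟧ v) (≡.sym (evalᶠ-[]ᶠ _ _ N a F))

  truth-suc : ∀ N F → truth (suc N) F ≡ truth N (F [ n+1 ]ᶠ)
  truth-suc N F = trans (cong (λ M → truth M F) (≡.sym (n+1-↓ᵃ N))) (truth-[]ᶠ N n+1 F)

  DefEq-leafTruth : ∀ N {F G} → DefEq D F G → ⟦ F ⟧ (leafTruth N) ≡ ⟦ G ⟧ (leafTruth N)
  DefEq-leafTruth N {F} {G} F~G = begin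
    ⟦ F ⟧ (leafTruth N)  ≡⟨ truth-leafTruth N F ⟨
    truth N F            ≡⟨ cong (λ H → ⟦ H ⟧ v) (DefEq-sound D N F~G) ⟩
    truth N G            ≡⟨ truth-leafTruth N G ⟩
    ⟦ G ⟧ (leafTruth N)  ∎
    where open ≡-Reasoning

  -- x takes the sequent of the link as an additional argument because the pattern
  -- lambda in charSpec is lifted over it.
  proof-refuted : ∀ {Σ Self V} {τ : CharSym Σ → ℕ → GroundTerm} {ξ : V → GroundTerm}
    {x : SequentSchema k → ∀ {S} → Self S → Config S → V} N →
    (∀ {S} (i : S ∈ Σ) Ω M → Falsified (truth M) (S · Ω) → GroundRefuted v (τ (charSym i Ω) M)) →
    ∀ {S} (φ : Proof D Σ Self S) Ω → Falsified (truth N) (S · Ω) →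
    (∀ S₀ {S} (s : Self S) Ω → Falsified (truth N) (S · Ω) → GroundRefuted v (ξ (x S₀ s Ω))) →
    GroundRefuted v (evalᵗ τ ξ N (Θ (λ {S} → charLink (x S)) φ Ω))
  proof-refuted {Σ} {Self} {V} {τ} {ξ} {x} N sym-refuted φ Ω f self-refuted =
    evalᵗ-refuted (Θ-refuted (leafTruth N) (DefEq-leafTruth N) link-refuted φ Ω
      (Falsified-cong (truth-leafTruth N) f))
    where
    link-refuted : ∀ {S} (ℓ : Link Σ Self S) Ω → Falsified (λ F → ⟦ F ⟧ (leafTruth N)) (S · Ω) →
      Refuted (v ∘ map₂ (_↓ᵃ N)) (GroundRefuted v ∘ evalᵗ τ ξ N ∘ ref) (charLink (x S) ℓ Ω)
    -- At parameter `N` the link stands for its symbol at `a ↓ᵃ N`, so the hypothesis on earlier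
    -- symbols is used at that value.
    link-refuted (sym {S} i a) Ω f = ref (sym-refuted i _ (a ↓ᵃ N)
      (Falsified-map⁻ _[ a ]ᶠ (λ F → trans (truth-[]ᶠ N a F) (truth-leafTruth N (F [ a ]ᶠ))) S Ω f))
    link-refuted (self s) Ω f =
      ref (self-refuted _ s Ω (Falsified-cong (λ F → ≡.sym (truth-leafTruth N F)) f))

  -- Induction on `N` for all configurations at once, because a self link inside the recursive proof
  -- may carry a configuration other than `Ω`.
  charSpec-refuted : ∀ {Σ S} (Ψ : ProofDefs D Σ) (ψ : ProofSpec D Σ S) →
    (∀ {S′} (i : S′ ∈ Σ) Ω N → Falsified (truth N) (S′ · Ω) →
       GroundRefuted v (unfoldᵗ (charDefs Ψ) (charSym i Ω) N)) →
    ∀ Ω N → Falsified (truth N) (S · Ω) → GroundRefuted v (unfoldᵗ (charDefs (Ψ ▸ ψ)) (inj₁ Ω) N)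
  charSpec-refuted {S = S} Ψ ψ sym-refuted Ω zero f =
    -- In a propositional proof the leaves are atoms, `def` is the identity and there are no links,
    -- so `v` serves as leaf valuation.
    Θ-refuted v (λ { refl → refl }) (λ ()) (ProofSpec.base ψ) _
      (Falsified-map⁺ (D ⊨_↓ᶠ 0) (λ _ → refl) S Ω f)
  charSpec-refuted {S = S} Ψ ψ sym-refuted Ω (suc N) f =
    proof-refuted N sym-refuted
      (ProofSpec.rec ψ) _ (Falsified-map⁺ _[ n+1 ]ᶠ (truth-suc N) S Ω f)
      (λ { _ refl Ω′ → charSpec-refuted Ψ ψ sym-refuted Ω′ N })

  -- Outer induction along the order of definitions: besides itself, a symbol links to earlier ones
  -- only.
  charSym-refuted : ∀ {Σ} (Ψ : ProofDefs D Σ) {S} (i : S ∈ Σ) (Ω : Config S) N →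
    Falsified (truth N) (S · Ω) → GroundRefuted v (unfoldᵗ (charDefs Ψ) (charSym i Ω) N)
  charSym-refuted (Ψ ▸ ψ) (here refl) = charSpec-refuted Ψ ψ (charSym-refuted Ψ)
  charSym-refuted (Ψ ▸ ψ) (there i)   = charSym-refuted Ψ i

characteristicTerm-unsat : ∀ φ N v →
  ∃ λ C → C ∈ ∣ characteristicTerm φ ↓ᵗ N ∣ × Falsified v C
characteristicTerm-unsat φ N v =
  falsified-clause (proof-refuted formulaDefs v N (charSym-refuted formulaDefs v proofDefs)
    proof (∅ endSequent) (∅-tracked (ant endSequent) , ∅-tracked (con endSequent)) (λ _ ()))
  where open ProofSchema φ

-- Top clauses

-- Each factor of the product puts its atom on one of the two sides.
CLᵗ-total : ∀ As {D} → D ∈ CLᵗ As → ∀ {A} → A ∈ As → A ∈ ant D ⊎ A ∈ con D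
CLᵗ-total (B ∷ As) D∈ A∈ with ∈-cartesianProductWith⁻ _∘ˢ_ (_ ∷ _ ∷ []) (CLᵗ As) D∈
CLᵗ-total (B ∷ As) D∈ (here refl) | _ , _ , here refl , _ , refl = inj₁ (here refl)
CLᵗ-total (B ∷ As) D∈ (here refl) | _ , _ , there (here refl) , _ , refl = inj₂ (here refl)
CLᵗ-total (B ∷ As) D∈ (there A∈) | _ , _ , here refl , E∈ , refl =
  Sum.map₁ there (CLᵗ-total As E∈ A∈)
CLᵗ-total (B ∷ As) D∈ (there A∈) | _ , _ , there (here refl) , E∈ , refl =
  Sum.map₂ there (CLᵗ-total As E∈ A∈)

CLᵗ-total-≈ᶜ : ∀ As {D} → D ∈ᶜ CLᵗ As → ∀ {A} → A ∈ As → A ∈ ant D ⊎ A ∈ con D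
CLᵗ-total-≈ᶜ As D∈ A∈ with find D∈
... | _ , D′∈ , Γ↭ , Δ↭ = Sum.map (∈-resp-↭ (↭-sym Γ↭)) (∈-resp-↭ (↭-sym Δ↭)) (CLᵗ-total As D′∈ A∈)

-- An atom of `ant C` is true, hence in `ant D`. An atom of `con C` is false, hence outside `ant D`;
-- it lies in `As` by `C⊆As`, and `total` then places it in `con D`.
falsified-≤ᶜ : ∀ {As : List (Atom ℕ)} {C D} → (∀ {A} → A ∈ As → A ∈ ant D ⊎ A ∈ con D) →
               (∀ A → A ∈ ant C ⊎ A ∈ con C → A ∈ As) →
               Falsified (λ A → does (A ∈? ant D)) C → C ≤ᶜ D
falsified-≤ᶜ {As} {C} {D} total C⊆As (ps , qs) =
  (λ A∈ → true⇒ant (lookup ps A∈)) , (λ A∈ → false⇒con (C⊆As _ (inj₂ A∈)) (lookup qs A∈))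
  where
  true⇒ant : ∀ {A} → does (A ∈? ant D) ≡ true → A ∈ ant D
  true⇒ant {A} p with A ∈? ant D
  ... | yes A∈ = A∈

  false⇒con : ∀ {A} → A ∈ As → does (A ∈? ant D) ≡ false → A ∈ con D
  false⇒con {A} A∈As p with A ∈? ant D
  ... | no A∉ = [ (λ A∈ → ⊥-elim (A∉ A∈)) , id ]′ (total A∈As)

-- Evaluation of refutation schemata

subsuming-clause : ∀ R N {D} → D ∈ᶜ CLᵗ (𝒜 R ↓ˢᵉᵗ N) → ∃ λ C → C ∈ᶜ ∣ Θᴿ R ↓ᵗ N ∣ × C ≤ᶜ D
-- Abstracting `Θᴿ R` together with the two fields that mention it allows the equation with a
-- characteristic term to be matched by `refl`.
subsuming-clause R N {D} D∈ with Θᴿ R | characteristic R | atomSet R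
... | _ | φ , refl | atomSetᴿ =
  let C , C∈ , f = characteristicTerm-unsat φ N (λ A → does (A ∈? ant D))
  in C , Any.map (λ { refl → ↭-refl , ↭-refl }) C∈
       , falsified-≤ᶜ (CLᵗ-total-≈ᶜ _ D∈) (atomSetᴿ N C C∈) f

weakening-exists : ∀ {𝒞 𝒟} → (∀ {D} → D ∈ᶜ 𝒟 → ∃ λ C → C ∈ᶜ 𝒞 × C ≤ᶜ D) →
                   ∀ {γ} → γ IsDeductionFrom 𝒟 → ∃ (WeakenedFrom 𝒞 γ)
weakening-exists f (clause D∈) = let C , C∈ , C≤D = f D∈ in _ , clause C∈ C≤D
weakening-exists f (r p q)     =
  Product.zip (λ γ δ → r γ δ _) r (weakening-exists f p) (weakening-exists f q)

-- Each leaf becomes a weakening of a member of `𝒞` and the resolution steps are kept, so any choice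
-- of subsuming clauses will do.
weakening-sound : ∀ {𝒞 γ δ} → WeakenedFrom 𝒞 γ δ → δ IsWDeductionFrom 𝒞
weakening-sound (clause C∈ _) = w (clause C∈)
weakening-sound (r p q)       = r (weakening-sound p) (weakening-sound q)

theorem7 : (R : RefutationSchema) (N : ℕ) →
    (∃ λ γ → R ↓ᴿ N ⇝ γ) ×
    (∀ γ → R ↓ᴿ N ⇝ γ → γ IsWDeductionFrom ∣ Θᴿ R ↓ᵗ N ∣)
theorem7 R N =
  -- The first component provides a value of the evaluation relation, so that the second is not
  -- vacuous.
  weakening-exists (subsuming-clause R N) (deduction R N) , λ _ → weakening-sound
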